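{- Let $H$ be any connected $K_4$-free graph on $5$ vertices that contains $K_3$ as a subgraph. If $H$ is isomorphic neither to $W_5 = K_1 + C_4$ nor to $\overline{P_2 \cup P_3}$, then the edge Folkman number $F_e(K_3,K_3;H)$ does not exist.
   Context: All graphs are finite, undirected and simple. $P_n$ is the path on $n$ vertices, $C_n$ the cycle on $n$ vertices, $\overline{G}$ the complement of $G$, $\cup$ disjoint union, and $K_1+C_4$ the join (a vertex adjacent to all vertices of a $4$-cycle). A graph is $H$-free if it contains no subgraph isomorphic to $H$. $F_e(K_3,K_3;H)$ is the smallest $n$ such that some $H$-free graph on $n$ vertices has every red-blue edge coloring containing a monochromatic $K_3$; it "exists" if such a graph exists. -}

module Defs where

open import Data.Bool using (Bool; true; false; not; _∧_)
open import Data.Nat using (ℕ)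
open import Data.Fin using (Fin; zero; suc; _≟_)
open import Data.Product using (Σ; ∃; _×_; _,_)
open import Relation.Nullary using (¬_; does)
open import Relation.Binary.PropositionalEquality using (_≡_)
open import Function.Definitions using (Injective)

record Graph (n : ℕ) : Set where
  field
    adj   : Fin n → Fin n → Bool
    adj-sym : ∀ u v → adj u v ≡ adj v u
    adj-irr : ∀ u → adj u u ≡ false
open Graph public

Adj : ∀ {n} → Graph n → Fin n → Fin n → Set
Adj G u v = adj G u v ≡ true

Contains : ∀ {m n} → Graph n → Graph m → Set
Contains {m} {n} G H =
  Σ (Fin m → Fin n) λ f → Injective _≡_ _≡_ f × (∀ u v → Adj H u v → Adj G (f u) (f v))

_Free_ : ∀ {m n} → Graph m → Graph n → Set
H Free G = ¬ Contains G H

K : (n : ℕ) → Graph n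
K n = record { adj = λ u v → not (does (u ≟ v)) ; adj-sym = s ; adj-irr = i }
  where
  open import Relation.Nullary using (yes; no)
  open import Relation.Binary.PropositionalEquality using (refl; sym)
  s : ∀ (u v : Fin n) → not (does (u ≟ v)) ≡ not (does (v ≟ u))
  s u v with u ≟ v | v ≟ u
  ... | yes _ | yes _ = refl
  ... | no _  | no _  = refl
  ... | yes p | no q  = Data.Empty.⊥-elim (q (sym p)) where import Data.Empty
  ... | no p  | yes q = Data.Empty.⊥-elim (p (sym q)) where import Data.Empty
  i : ∀ (u : Fin n) → not (does (u ≟ u)) ≡ false
  i u with u ≟ u
  ... | yes _ = refl
  ... | no p = Data.Empty.⊥-elim (p refl) where import Data.Empty

complement : ∀ {n} → Graph n → Graph n
complement {n} G = record { adj = a ; adj-sym = s ; adj-irr = i }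
  where
  open import Relation.Nullary using (yes; no)
  open import Relation.Binary.PropositionalEquality using (refl; cong; cong₂)
  a : Fin n → Fin n → Bool
  a u v = not (adj G u v) ∧ not (does (u ≟ v))
  s : ∀ u v → a u v ≡ a v u
  s u v = cong₂ _∧_ (cong not (Graph.adj-sym G u v)) (Graph.adj-sym (K n) u v)
  i : ∀ u → a u u ≡ false
  i u with u ≟ u
  ... | yes _ = Data.Bool.Properties.∧-zeroʳ (not (adj G u u))
    where import Data.Bool.Properties
  ... | no p = Data.Empty.⊥-elim (p refl) where import Data.Empty

fromEdges : ∀ {n} → (Fin n → Fin n → Bool) → Graph n
fromEdges {n} e = record { adj = a ; adj-sym = s ; adj-irr = i }
  where
  open import Data.Bool using (_∨_)
  open import Data.Bool.Properties using (∨-comm; ∧-zeroʳ)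
  open import Relation.Nullary using (yes; no)
  open import Relation.Binary.PropositionalEquality using (refl; cong₂)
  a : Fin n → Fin n → Bool
  a u v = (e u v ∨ e v u) ∧ not (does (u ≟ v))
  s : ∀ u v → a u v ≡ a v u
  s u v = cong₂ _∧_ (∨-comm (e u v) (e v u)) (Graph.adj-sym (K n) u v)
  i : ∀ u → a u u ≡ false
  i u with u ≟ u
  ... | yes _ = ∧-zeroʳ (e u u ∨ e u u)
  ... | no p = Data.Empty.⊥-elim (p refl) where import Data.Empty

data Reach {n} (G : Graph n) : Fin n → Fin n → Set where
  here : ∀ {u} → Reach G u u
  step : ∀ {u v w} → Adj G u v → Reach G v w → Reach G u w

Connected : ∀ {n} → Graph n → Set
Connected {n} G = ∀ (u v : Fin n) → Reach G u v

record _≅_ {n} (G H : Graph n) : Set where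
  field
    to      : Fin n → Fin n
    from    : Fin n → Fin n
    to-from : ∀ x → to (from x) ≡ x
    from-to : ∀ x → from (to x) ≡ x
    pres    : ∀ u v → adj H (to u) (to v) ≡ adj G u v

v0 v1 v2 v3 v4 : Fin 5
v0 = zero
v1 = suc zero
v2 = suc (suc zero)
v3 = suc (suc (suc zero))
v4 = suc (suc (suc (suc zero)))

W5 : Graph 5
W5 = fromEdges e
  where
  e : Fin 5 → Fin 5 → Bool
  e zero _ = true
  e (suc zero) (suc (suc zero)) = true
  e (suc (suc zero)) (suc (suc (suc zero))) = true
  e (suc (suc (suc zero))) (suc (suc (suc (suc zero)))) = true
  e (suc (suc (suc (suc zero)))) (suc zero) = true
  e _ _ = false

P2∪P3 : Graph 5
P2∪P3 = fromEdges e
  where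
  e : Fin 5 → Fin 5 → Bool
  e zero (suc zero) = true
  e (suc (suc zero)) (suc (suc (suc zero))) = true
  e (suc (suc (suc zero))) (suc (suc (suc (suc zero)))) = true
  e _ _ = false

MonoTriangle : ∀ {n} → Graph n → (Fin n → Fin n → Bool) → Set
MonoTriangle {n} G c = Σ (Fin n) λ a → Σ (Fin n) λ b → Σ (Fin n) λ d →
  Adj G a b × Adj G b d × Adj G a d × c a b ≡ c b d × c a b ≡ c a d

Arrows : ∀ {n} → Graph n → Set
Arrows {n} G = ∀ (c : Fin n → Fin n → Bool) → (∀ u v → c u v ≡ c v u) → MonoTriangle G c

FolkmanExists : ∀ {m} → Graph m → Set
FolkmanExists H = Σ ℕ λ n → Σ (Graph n) λ G → H Free G × Arrows G

{-# OPTIONS --safe #-}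
module Submission where

-- A K₄-free graph on five vertices other than W₅ and the complement of P₂ ∪ P₃ is a subgraph of
-- the gem K₁ + P₄ or of the book K₁,₁,₃, so it suffices to colour the edges of a graph G that is
-- gem-free or book-free.  A triangle with an edge lying on no other triangle can be coloured last.
-- Among the remaining triangles every edge lies on at most two: for book-free G this is clear, and
-- if three of them shared u v, a further triangle on the edge u w of one of them would give a gem
-- with hub u.  Not-all-equal constraints on triples in which every variable occurs at most
-- twice are always satisfiable, by eliminating one constraint and one variable at a time.

open import Defs
open import Relation.Nullary using (¬_)
open import Data.Bool using (Bool; true; false; not; _xor_; _∧_; _∨_; if_then_else_)
open import Data.Bool.Properties using (not-¬; not-distribˡ-xor; xor-assoc; xor-same; xor-identityʳ; ∨-comm; ∨-identityʳ) renaming (_≟_ to _≟ᵇ_)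
open import Data.Fin using (Fin; zero; suc; inject₁; _<_; _<?_; _≟_)
open import Data.Fin.Permutation using (Permutation′; insert; inverseˡ; inverseʳ; _⟨$⟩ʳ_; _⟨$⟩ˡ_) renaming (id to idₚ)
open import Data.Fin.Properties using (all?; <-cmp; <-trans; <-asym; <⇒≢; inject₁-injective)
open import Data.List using (List; []; _∷_; [_]; map; concatMap; length; filter; allFin; cartesianProduct)
open import Data.List.Membership.Propositional using (_∈_)
open import Data.List.Membership.Propositional.Properties using (∈-allFin; ∈-cartesianProduct⁺; ∈-filter⁺)
open import Data.List.Properties using (length-map; map-∘)
open import Data.List.Relation.Unary.All as All using (All; []; _∷_)
open import Data.List.Relation.Unary.All.Properties using (all-filter) renaming (map⁻ to All-map⁻; filter⁺ to All-filter⁺)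
open import Data.List.Relation.Unary.Any as Any using (Any; any?; here; there)
open import Data.List.Relation.Unary.Unique.Propositional using (Unique; []; _∷_)
open import Data.List.Relation.Unary.Unique.Propositional.Properties using (allFin⁺; cartesianProduct⁺; filter⁺)
open import Data.Nat using (ℕ; zero; suc; _+_; _≤_; z≤n; s≤s; s≤s⁻¹)
open import Data.Nat.ListAction using (sum)
open import Data.Nat.Properties using (≤-refl; ≤-reflexive; ≤-trans; +-mono-≤; m≤m+n; m≤n+m; n≤0⇒n≡0; suc-injective; m+n≡0⇒m≡0; m+n≡0⇒n≡0)
open import Data.Nat.Tactic.RingSolver using (solve-∀)
open import Data.Product using (∃; _×_; _,_; proj₁; proj₂)
open import Data.Product.Properties using (≡-dec)
open import Data.Sum as Sum using (_⊎_; inj₁; inj₂)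
open import Data.Unit using (⊤; tt)
open import Data.Vec using (Vec; []; _∷_; lookup; tabulate)
open import Data.Vec.Properties using (lookup∘tabulate)
open import Data.Vec.Relation.Unary.All using ([]; _∷_)
open import Data.Vec.Relation.Unary.AllPairs using ([]; _∷_)
open import Data.Vec.Relation.Unary.Unique.Propositional.Properties using (lookup-injective)
open import Function using (_∘_; const; id)
open import Relation.Binary.Definitions using (DecidableEquality; tri<; tri≈; tri>)
open import Relation.Binary.PropositionalEquality using (_≡_; _≢_; refl; sym; trans; cong; cong₂; subst; ≢-sym)
open import Relation.Nullary using (Dec; does; yes; no; contradiction)
open import Relation.Nullary.Decidable using (¬?; dec-true; dec-false; map′; toWitness; _×-dec_; _⊎-dec_; _→-dec_)
open import Relation.Unary using (Decidable)

-- Not-all-equal satisfiability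

NotAllEqual : Bool → Bool → Bool → Set
NotAllEqual a b c = ¬ (a ≡ b × a ≡ c)

NotAllEqual-resp : ∀ {a a′ b b′ c c′} → a ≡ a′ → b ≡ b′ → c ≡ c′ →
  NotAllEqual a′ b′ c′ → NotAllEqual a b c
NotAllEqual-resp refl refl refl nae = nae

module NAE-SAT {V : Set} (_≟_ : DecidableEquality V) where

  -- The clauses of triangles are all positive; signs appear because the elimination step replaces a
  -- variable by another one, possibly negated.
  Literal Clause Assignment : Set
  Literal    = V × Bool
  Clause     = Literal × Literal × Literal
  Assignment = V → Bool

  eval : Assignment → Literal → Bool
  eval σ (v , s) = s xor σ v

  NAE : Assignment → Clause → Set
  NAE σ (k , l , m) = NotAllEqual (eval σ k) (eval σ l) (eval σ m)

  Satisfiable : List Clause → Set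
  Satisfiable L = ∃ λ σ → All (NAE σ) L

  assign : Assignment → Literal → Bool → Assignment
  assign σ (x , s) b v = if does (v ≟ x) then s xor b else σ v

  eval-assign : ∀ σ l b → eval (assign σ l b) l ≡ b
  eval-assign σ (x , s) b with x ≟ x
  ... | no x≢x = contradiction refl x≢x
  ... | yes _  = trans (sym (xor-assoc s s b)) (cong (_xor b) (xor-same s))

  eval-assign-≢ : ∀ σ l b m → proj₁ l ≢ proj₁ m → eval (assign σ l b) m ≡ eval σ m
  eval-assign-≢ σ (x , s) b (y , t) x≢y with y ≟ x
  ... | yes y≡x = contradiction (sym y≡x) x≢y
  ... | no _    = refl

  _∉_ : V → Clause → Set
  x ∉ ((u , _) , (v , _) , (w , _)) = x ≢ u × x ≢ v × x ≢ w

  NAE-assign : ∀ σ l b c → proj₁ l ∉ c → NAE σ c → NAE (assign σ l b) c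
  NAE-assign σ l b (k , m , n) (k≢ , m≢ , n≢) = NotAllEqual-resp
    (eval-assign-≢ σ l b k k≢) (eval-assign-≢ σ l b m m≢) (eval-assign-≢ σ l b n n≢)

  separate : Assignment → Literal → Literal → Assignment
  separate σ k l = assign σ k (not (eval σ l))

  eval-separate : ∀ σ k l → proj₁ k ≢ proj₁ l →
    eval (separate σ k l) k ≢ eval (separate σ k l) l
  eval-separate σ k l k≢l eq = not-¬ {eval σ l} refl
    (trans (sym (eval-assign-≢ σ k _ l k≢l)) (trans (sym eq) (eval-assign σ k _)))

  occurs : V → Literal → ℕ
  occurs v (w , _) = if does (v ≟ w) then 1 else 0

  -- Counted with multiplicity: after a substitution one variable may fill several places of a
  -- clause.
  occurrences : V → Clause → ℕ
  occurrences v (k , l , m) = occurs v k + occurs v l + occurs v m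

  total : V → List Clause → ℕ
  total v L = sum (map (occurrences v) L)

  occurs-self : ∀ x s → occurs x (x , s) ≡ 1
  occurs-self x s with x ≟ x
  ... | yes _  = refl
  ... | no x≢x = contradiction refl x≢x

  occurs≡0⇒≢ : ∀ {v} l → occurs v l ≡ 0 → v ≢ proj₁ l
  occurs≡0⇒≢ {v} (w , _) eq with v ≟ w
  ... | no v≢w = v≢w

  occurrences≡0⇒∉ : ∀ {v} c → occurrences v c ≡ 0 → v ∉ c
  occurrences≡0⇒∉ {v} (k , l , m) eq =
      occurs≡0⇒≢ k (m+n≡0⇒m≡0 (occurs v k) kl≡0)
    , occurs≡0⇒≢ l (m+n≡0⇒n≡0 (occurs v k) kl≡0)
    , occurs≡0⇒≢ m (m+n≡0⇒n≡0 (occurs v k + occurs v l) eq)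
    where kl≡0 = m+n≡0⇒m≡0 (occurs v k + occurs v l) eq

  total≡0⇒∉ : ∀ {v} L → total v L ≡ 0 → All (v ∉_) L
  total≡0⇒∉     []      eq = []
  total≡0⇒∉ {v} (c ∷ L) eq =
    occurrences≡0⇒∉ c (m+n≡0⇒m≡0 (occurrences v c) eq) ∷
    total≡0⇒∉ L (m+n≡0⇒n≡0 (occurrences v c) eq)

  -- A substitution for the variable y, making the literal (y , t) the negation of (x , s).
  oppose : Literal → Literal → Literal → Literal
  oppose (x , s) (y , t) (v , r) =
    -- `(y , t)` negates `(x , s)` exactly when `y` equals `t xor not s xor x`; the sign `r` is
    -- added to this.
    if does (v ≟ y) then (x , r xor (t xor not s)) else (v , r)

  opposeᶜ : Literal → Literal → Clause → Clause
  opposeᶜ p q (k , l , m) = oppose p q k , oppose p q l , oppose p q m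

  -- `separate` gives `y` the very value that `oppose` substitutes for it, so a solution of the
  -- substituted clauses lifts back.
  eval-oppose : ∀ σ p q l → eval (separate σ q p) l ≡ eval σ (oppose p q l)
  eval-oppose σ (x , s) (y , t) (v , r) with v ≟ y
  ... | no _  = refl
  ... | yes _ = trans (cong (λ b → r xor (t xor b)) (not-distribˡ-xor s (σ x)))
                (trans (cong (r xor_) (sym (xor-assoc t (not s) (σ x))))
                       (sym (xor-assoc r (t xor not s) (σ x))))

  NAE-oppose : ∀ σ p q c → NAE σ (opposeᶜ p q c) → NAE (separate σ q p) c
  NAE-oppose σ p q (k , l , m) = NotAllEqual-resp
    (eval-oppose σ p q k) (eval-oppose σ p q l) (eval-oppose σ p q m)

  occurs-oppose : ∀ p q l →
    occurs (proj₁ p) (oppose p q l) ≤ occurs (proj₁ p) l + occurs (proj₁ q) l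
  occurs-oppose (x , s) (y , t) (v , r) with v ≟ y
  ... | no _     = m≤m+n _ _
  ... | yes refl rewrite occurs-self x (r xor (t xor not s)) | occurs-self v r = m≤n+m 1 _

  occurs-oppose-≢ : ∀ {v} p q l → v ≢ proj₁ p → occurs v (oppose p q l) ≤ occurs v l
  occurs-oppose-≢ {v} (x , s) (y , t) (w , r) v≢x with w ≟ y
  ... | no _ = ≤-refl
  ... | yes _ with v ≟ x
  ...   | yes v≡x = contradiction v≡x v≢x
  ...   | no _    = z≤n

  total-oppose : ∀ p q L →
    total (proj₁ p) (map (opposeᶜ p q) L) ≤ total (proj₁ p) L + total (proj₁ q) L
  total-oppose p q []                = z≤n
  total-oppose p q ((k , l , m) ∷ L) = ≤-trans
    (+-mono-≤ (+-mono-≤ (+-mono-≤ (occurs-oppose p q k) (occurs-oppose p q l))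
                        (occurs-oppose p q m))
              (total-oppose p q L))
    (≤-reflexive (regroup (occurs x k) (occurs y k) (occurs x l) (occurs y l)
                           (occurs x m) (occurs y m) _ _))
    where
    x = proj₁ p
    y = proj₁ q
    regroup : ∀ a a′ b b′ c c′ d d′ →
      (a + a′) + (b + b′) + (c + c′) + (d + d′) ≡ (a + b + c + d) + (a′ + b′ + c′ + d′)
    regroup = solve-∀

  total-oppose-≢ : ∀ {v} p q L → v ≢ proj₁ p → total v (map (opposeᶜ p q) L) ≤ total v L
  total-oppose-≢ p q []                v≢ = z≤n
  total-oppose-≢ p q ((k , l , m) ∷ L) v≢ =
    +-mono-≤ (+-mono-≤ (+-mono-≤ (occurs-oppose-≢ p q k v≢) (occurs-oppose-≢ p q l v≢))
                       (occurs-oppose-≢ p q m v≢))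
             (total-oppose-≢ p q L v≢)

  xor-cancelʳ : ∀ a b c → a xor c ≡ b xor c → a ≡ b
  xor-cancelʳ a b c eq =
    trans (sym (lemma a)) (trans (cong (_xor c) eq) (lemma b))
    where
    lemma : ∀ a → (a xor c) xor c ≡ a
    lemma a = trans (xor-assoc a c c) (trans (cong (a xor_) (xor-same c)) (xor-identityʳ a))

  -- Induction on the number of clauses: two literals of the first clause on distinct variables
  -- are declared opposite, which eliminates one variable without creating a third occurrence.
  twice-satisfiable : ∀ L → (∀ v → total v L ≤ 2) → Satisfiable L
  twice-satisfiable L = go (length L) L refl
    where
    go : ∀ k L → length L ≡ k → (∀ v → total v L ≤ 2) → Satisfiable L
    go zero    []      _   _  = (λ _ → false) , []
    go (suc k) (((x , s) , (y , t) , (z , r)) ∷ L) len ≤2 with x ≟ y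
    ... | no x≢y =
      let σ , sat = go k (map (opposeᶜ p q) L) (trans (length-map _ L) (suc-injective len)) bound
      in separate σ q p ,
         (λ (e , _) → eval-separate σ q p (x≢y ∘ sym) (sym e)) ∷
         All.map (λ {c} → NAE-oppose σ p q c) (All-map⁻ sat)
      where
      p = x , s
      q = y , t
      -- The first clause uses one of the at most two occurrences of `x`, and likewise of `y`;
      -- merging what remains gives `x` at most 1 + 1.
      x≤1 : total x L ≤ 1
      x≤1 = s≤s⁻¹ (≤-trans (+-mono-≤ (≤-trans (≤-reflexive (sym (occurs-self x s)))
              (≤-trans (m≤m+n _ _) (m≤m+n _ _))) ≤-refl) (≤2 x))
      y≤1 : total y L ≤ 1
      y≤1 = s≤s⁻¹ (≤-trans (+-mono-≤ (≤-trans (≤-reflexive (sym (occurs-self y t)))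
              (≤-trans (m≤n+m _ (occurs y p)) (m≤m+n _ _))) ≤-refl) (≤2 y))
      bound : ∀ v → total v (map (opposeᶜ p q) L) ≤ 2
      bound v with v ≟ x
      ... | yes refl = ≤-trans (total-oppose p q L) (+-mono-≤ x≤1 y≤1)
      ... | no v≢x   = ≤-trans (total-oppose-≢ p q L v≢x) (≤-trans (m≤n+m _ _) (≤2 v))
    ... | yes refl with s ≟ᵇ t
    -- Literals of opposite sign on one variable differ under every assignment.
    ...   | no s≢t =
      let σ , sat = go k L (suc-injective len) (λ v → ≤-trans (m≤n+m _ _) (≤2 v))
      in σ , (λ (e , _) → s≢t (xor-cancelʳ s t (σ x) e)) ∷ sat
    -- Both occurrences of `x` are spent here, so `x` is neither `z` nor in `L` and can be set last,
    -- opposite to the third literal.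
    ...   | yes refl =
      let σ , sat = go k L (suc-injective len) (λ v → ≤-trans (m≤n+m _ _) (≤2 v))
      in separate σ (x , s) (z , r) ,
         (λ (_ , e) → eval-separate σ (x , s) (z , r) x≢z e) ∷
         All.zipWith (λ {c} (x∉c , nae) → NAE-assign σ (x , s) _ c x∉c nae) (total≡0⇒∉ L x∉L , sat)
      where
      rest≡0 : occurs x (z , r) + total x L ≡ 0
      rest≡0 = n≤0⇒n≡0 (s≤s⁻¹ (s≤s⁻¹
        (subst (λ o → o + o + occurs x (z , r) + total x L ≤ 2) (occurs-self x s) (≤2 x))))
      x≢z : x ≢ z
      x≢z = occurs≡0⇒≢ (z , r) (m+n≡0⇒m≡0 _ rest≡0)
      x∉L : total x L ≡ 0
      x∉L = m+n≡0⇒n≡0 (occurs x (z , r)) rest≡0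

-- Colouring gem-free and book-free graphs

module _ {A : Set} where

  -- Excludes `k + 1` pairwise distinct solutions of `P`. The nesting makes `AtMost 2` unfold to
  -- three solutions with their inequalities, ready to be refuted.
  AtMost : ℕ → (A → Set) → Set
  AtMost zero    P = ∀ x → ¬ P x
  AtMost (suc k) P = ∀ x → P x → AtMost k (λ y → P y × x ≢ y)

  -- Each entry of weight 1 spends one unit of `k`; uniqueness of the list keeps later entries
  -- distinct from it.
  sum-indicator≤ : ∀ {k P} (g : A → ℕ) {L} → Unique L →
    All (λ x → g x ≡ 0 ⊎ g x ≡ 1 × P x) L → AtMost k P → sum (map g L) ≤ k
  sum-indicator≤ g []       []                           _ = z≤n
  sum-indicator≤ g (_ ∷ uL) (inj₁ gx≡0 ∷ h)              few rewrite gx≡0 =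
    sum-indicator≤ g uL h few
  sum-indicator≤ {zero}  g (_ ∷ uL)   (inj₂ (_ , px) ∷ h)    few = contradiction px (few _)
  sum-indicator≤ {suc k} g (x≢L ∷ uL) (inj₂ (gx≡1 , px) ∷ h) few rewrite gx≡1 =
    s≤s (sum-indicator≤ g uL
      (All.zipWith (λ { (inj₁ 0≡ , _) → inj₁ 0≡ ; (inj₂ (1≡ , py) , x≢y) → inj₂ (1≡ , py , x≢y) })
                   (h , x≢L))
      (few _ px))

upperPairs : ∀ n → List (Fin n × Fin n)
upperPairs n = filter (λ (u , v) → u <? v) (cartesianProduct (allFin n) (allFin n))

∈-upperPairs : ∀ {n} {u v : Fin n} → u < v → (u , v) ∈ upperPairs n
∈-upperPairs {u = u} {v} =
  ∈-filter⁺ (λ (u , v) → u <? v) (∈-cartesianProduct⁺ (∈-allFin u) (∈-allFin v))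

from-upperPairs : ∀ {n} {P : Fin n → Fin n → Set} → (∀ u → P u u) → (∀ {u v} → P u v → P v u) →
  All (λ (u , v) → P u v) (upperPairs n) → ∀ u v → P u v
from-upperPairs {n} {P} P-refl P-sym h u v with <-cmp u v
... | tri< u<v _ _  = All.lookup h (∈-upperPairs u<v)
... | tri≈ _ refl _ = P-refl u
... | tri> _ _ v<u  = P-sym (All.lookup h (∈-upperPairs v<u))

Adj-sym : ∀ {n} (G : Graph n) {u v} → Adj G u v → Adj G v u
Adj-sym G {u} {v} = trans (adj-sym G v u)

Adj-≢ : ∀ {n} (G : Graph n) {u v} → Adj G u v → u ≢ v
Adj-≢ G {u} uu refl = contradiction (trans (sym uu) (adj-irr G u)) λ ()

hom-from-upperPairs : ∀ {m n} (G : Graph n) (H : Graph m) (f : Fin m → Fin n) →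
  All (λ (u , v) → Adj H u v → Adj G (f u) (f v)) (upperPairs m) →
  ∀ u v → Adj H u v → Adj G (f u) (f v)
hom-from-upperPairs G H f = from-upperPairs
  (λ u uu → contradiction refl (Adj-≢ H uu)) (λ h → Adj-sym G ∘ h ∘ Adj-sym H)

-- The join of the vertex v4 and the path v1 v3 v0 v2.
Gem : Graph 5
Gem = fromEdges e
  where
  e : Fin 5 → Fin 5 → Bool
  e (suc (suc (suc (suc zero)))) _ = true
  e (suc zero) (suc (suc (suc zero))) = true
  e (suc (suc (suc zero))) zero = true
  e zero (suc (suc zero)) = true
  e _ _ = false

-- K₁,₁,₃ with the pair of adjacent centres v3 v4.
Book : Graph 5
Book = fromEdges e
  where
  e : Fin 5 → Fin 5 → Bool
  e (suc (suc (suc _))) _ = true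
  e _ _ = false

module _ {n} (G : Graph n) where

  gem-in : ∀ {c p q r s} → Adj G c p → Adj G c q → Adj G c r → Adj G c s →
    Adj G p q → Adj G q r → Adj G r s → p ≢ r → p ≢ s → q ≢ s → Contains G Gem
  gem-in {c} {p} {q} {r} {s} cp cq cr cs pq qr rs p≢r p≢s q≢s =
    lookup vs ,
    (λ {i} {j} → lookup-injective
      ( (≢-sym p≢r ∷ Adj-≢ G rs ∷ ≢-sym (Adj-≢ G qr) ∷ ≢-sym (Adj-≢ G cr) ∷ [])
      ∷ (p≢s ∷ Adj-≢ G pq ∷ ≢-sym (Adj-≢ G cp) ∷ [])
      ∷ (≢-sym q≢s ∷ ≢-sym (Adj-≢ G cs) ∷ [])
      ∷ (≢-sym (Adj-≢ G cq) ∷ []) ∷ [] ∷ []) i j) ,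
    hom-from-upperPairs G Gem (lookup vs)
      ( (λ ()) ∷ (λ _ → rs) ∷ (λ _ → Adj-sym G qr) ∷ (λ _ → Adj-sym G cr)
      ∷ (λ ()) ∷ (λ _ → pq) ∷ (λ _ → Adj-sym G cp)
      ∷ (λ ()) ∷ (λ _ → Adj-sym G cs) ∷ (λ _ → Adj-sym G cq) ∷ [])
    where
    vs : Vec (Fin n) 5
    -- This order sends the path `v1 v3 v0 v2` of `Gem` to `p q r s` and the hub `v4` to `c`.
    vs = r ∷ p ∷ s ∷ q ∷ c ∷ []

  book-in : ∀ {u v x y z} → Adj G u v → Adj G u x → Adj G v x → Adj G u y → Adj G v y →
    Adj G u z → Adj G v z → x ≢ y → x ≢ z → y ≢ z → Contains G Book
  book-in {u} {v} {x} {y} {z} uv ux vx uy vy uz vz x≢y x≢z y≢z =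
    lookup vs ,
    (λ {i} {j} → lookup-injective
      ( (x≢y ∷ x≢z ∷ ≢-sym (Adj-≢ G ux) ∷ ≢-sym (Adj-≢ G vx) ∷ [])
      ∷ (y≢z ∷ ≢-sym (Adj-≢ G uy) ∷ ≢-sym (Adj-≢ G vy) ∷ [])
      ∷ (≢-sym (Adj-≢ G uz) ∷ ≢-sym (Adj-≢ G vz) ∷ [])
      ∷ (Adj-≢ G uv ∷ []) ∷ [] ∷ []) i j) ,
    hom-from-upperPairs G Book (lookup vs)
      ( (λ ()) ∷ (λ ()) ∷ (λ _ → Adj-sym G ux) ∷ (λ _ → Adj-sym G vx)
      ∷ (λ ()) ∷ (λ _ → Adj-sym G uy) ∷ (λ _ → Adj-sym G vy)
      ∷ (λ _ → Adj-sym G uz) ∷ (λ _ → Adj-sym G vz) ∷ (λ _ → uv) ∷ [])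
    where
    vs : Vec (Fin n) 5
    vs = x ∷ y ∷ z ∷ u ∷ v ∷ []

  -- Otherwise z prolongs the path w v w′ or the path w v w″ in the neighbourhood of u.
  gem-free-third-vertex : ∀ {u v w w′ w″} → Adj G u v → Adj G u w → Adj G v w → Adj G u w′ → Adj G v w′ →
    Adj G u w″ → Adj G v w″ → w ≢ w′ → w ≢ w″ → w′ ≢ w″ →
    Gem Free G → ∀ z → Adj G u z → Adj G w z → z ≡ v
  gem-free-third-vertex {v = v} {w′ = w′} uv uw vw uw′ vw′ uw″ vw″ w≢w′ w≢w″ w′≢w″ free z uz wz
    with z ≟ v | z ≟ w′
  ... | yes z≡v | _       = z≡v
  ... | no z≢v  | no z≢w′ = contradiction
    (gem-in uz uw uv uw′ (Adj-sym G wz) (Adj-sym G vw) vw′ z≢v z≢w′ w≢w′) free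
  ... | no z≢v  | yes refl = contradiction
    (gem-in uz uw uv uw″ (Adj-sym G wz) (Adj-sym G vw) vw″ z≢v w′≢w″ w≢w″) free

  -- Triangles and their private edges

  Edge Triple : Set
  Edge   = Fin n × Fin n
  Triple = Fin n × Fin n × Fin n

  -- Sorting represents each triangle by one triple and each of its edges by one pair, so that
  -- occurrences of an edge count triangles.
  Triangle : Triple → Set
  Triangle (a , b , d) = a < b × b < d × Adj G a b × Adj G b d × Adj G a d

  triangle? : Decidable Triangle
  triangle? (a , b , d) =
    a <? b ×-dec b <? d ×-dec adj G a b ≟ᵇ true ×-dec adj G b d ≟ᵇ true ×-dec adj G a d ≟ᵇ true

  -- The middle index is the vertex opposite to the edge.
  data Side : Edge → Fin n → Triple → Set where
    ab : ∀ {a b d} → Side (a , b) d (a , b , d)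
    bd : ∀ {a b d} → Side (b , d) a (a , b , d)
    ad : ∀ {a b d} → Side (a , d) b (a , b , d)

  -- The position of `w` relative to the ends of `e` fixes the constructor; two different
  -- constructors impose contradictory orders.
  side-determines : ∀ {e w s t} → Triangle s → Triangle t → Side e w s → Side e w t → s ≡ t
  side-determines _ _ ab ab = refl
  side-determines _ _ bd bd = refl
  side-determines _ _ ad ad = refl
  side-determines (a<b , b<d , _) (d<a , _) ab bd = contradiction (<-trans a<b b<d) (<-asym d<a)
  side-determines (_ , b<d , _) (_ , d<b , _) ab ad = contradiction b<d (<-asym d<b)
  side-determines (d<a , _) (a<b , b<d , _) bd ab = contradiction (<-trans a<b b<d) (<-asym d<a)
  side-determines (a<b , _) (b<a , _) bd ad = contradiction a<b (<-asym b<a)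
  side-determines (_ , d<b , _) (_ , b<d , _) ad ab = contradiction b<d (<-asym d<b)
  side-determines (b<a , _) (a<b , _) ad bd = contradiction a<b (<-asym b<a)

  side-adj : ∀ {u v w t} → Triangle t → Side (u , v) w t → Adj G u v × Adj G u w × Adj G v w
  side-adj (_ , _ , ab′ , bd′ , ad′) ab = ab′ , ad′ , bd′
  side-adj (_ , _ , ab′ , bd′ , ad′) bd = bd′ , Adj-sym G ab′ , Adj-sym G ad′
  side-adj (_ , _ , ab′ , bd′ , ad′) ad = ad′ , ab′ , Adj-sym G bd′

  -- For a triangle on `u`, `v`, `w`, this says that the edge `u v` lies on no other triangle.
  Private : Fin n → Fin n → Fin n → Set
  Private u v w = ∀ z → Adj G u z → Adj G v z → z ≡ w

  private? : ∀ u v w → Dec (Private u v w)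
  private? u v w = all? λ z → adj G u z ≟ᵇ true →-dec (adj G v z ≟ᵇ true →-dec z ≟ w)

  HasPrivateEdge : Triple → Set
  HasPrivateEdge (a , b , d) = Private a b d ⊎ Private b d a ⊎ Private a d b

  hasPrivateEdge? : Decidable HasPrivateEdge
  hasPrivateEdge? (a , b , d) = private? a b d ⊎-dec (private? b d a ⊎-dec private? a d b)

  -- Three triangles on one edge have distinct third vertices and so form a book. In a gem-free
  -- graph `gem-free-third-vertex` makes the edge `u w` of the first triangle private, contradicting
  -- `stuck`.
  at-most-two : Gem Free G ⊎ Book Free G → ∀ e →
    AtMost 2 (λ t → (Triangle t × ¬ HasPrivateEdge t) × ∃ λ w → Side e w t)
  at-most-two free (u , v) t ((tri , stuck) , w , side)
      t′ (((tri′ , _) , w′ , side′) , t≢t′) t″ ((((tri″ , _) , w″ , side″) , t≢t″) , t′≢t″) =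
    refute free
    where
    uv : Adj G u v
    uv = proj₁ (side-adj tri side)
    w≢w′ : w ≢ w′
    w≢w′ refl = t≢t′ (side-determines tri tri′ side side′)
    w≢w″ : w ≢ w″
    w≢w″ refl = t≢t″ (side-determines tri tri″ side side″)
    w′≢w″ : w′ ≢ w″
    w′≢w″ refl = t′≢t″ (side-determines tri′ tri″ side′ side″)
    refute : ¬ (Gem Free G ⊎ Book Free G)
    refute (inj₂ book-free)
      with _ , uw , vw ← side-adj tri side
         | _ , uw′ , vw′ ← side-adj tri′ side′
         | _ , uw″ , vw″ ← side-adj tri″ side″ =
      book-free (book-in uv uw vw uw′ vw′ uw″ vw″ w≢w′ w≢w″ w′≢w″)
    refute (inj₁ gem-free)
      with _ , uw , vw ← side-adj tri side
         | _ , uw′ , vw′ ← side-adj tri′ side′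
         | _ , uw″ , vw″ ← side-adj tri″ side″ =
      exposed side (gem-free-third-vertex uv uw vw uw′ vw′ uw″ vw″ w≢w′ w≢w″ w′≢w″ gem-free)
      where
      exposed : Side (u , v) w t → ¬ Private u w v
      exposed ab p = stuck (inj₂ (inj₂ p))
      exposed bd p = stuck (inj₁ λ z az bz → p z bz az)
      exposed ad p = stuck (inj₁ p)

  -- Triangles as not-all-equal clauses

  _≟ₑ_ : DecidableEquality Edge
  _≟ₑ_ = ≡-dec _≟_ _≟_

  open NAE-SAT _≟ₑ_

  clause : Triple → Clause
  clause (a , b , d) = ((a , b) , false) , ((b , d) , false) , ((a , d) , false)

  -- Since `a < b < d`, the three sides are distinct pairs, so no edge is counted twice in one
  -- clause.
  occurrences-clause : ∀ e {t} → Triangle t →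
    occurrences e (clause t) ≡ 0 ⊎ occurrences e (clause t) ≡ 1 × ∃ λ w → Side e w t
  occurrences-clause e {a , b , d} (a<b , b<d , _)
    with e ≟ₑ (a , b) | e ≟ₑ (b , d) | e ≟ₑ (a , d)
  ... | yes refl | yes refl | _        = contradiction refl (<⇒≢ a<b)
  ... | yes refl | no _     | yes refl = contradiction refl (<⇒≢ b<d)
  ... | yes refl | no _     | no _     = inj₂ (refl , d , ab)
  ... | no _     | yes refl | yes refl = contradiction refl (<⇒≢ a<b)
  ... | no _     | yes refl | no _     = inj₂ (refl , a , bd)
  ... | no _     | no _     | yes refl = inj₂ (refl , b , ad)
  ... | no _     | no _     | no _     = inj₁ refl

  ∉-clause : ∀ {e t} → (∀ w → ¬ Side e w t) → e ∉ clause t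
  ∉-clause ¬side = (λ { refl → ¬side _ ab }) , (λ { refl → ¬side _ bd }) , (λ { refl → ¬side _ ad })

  Proper : Assignment → Triple → Set
  Proper σ t = NAE σ (clause t)

  -- The third vertex of a triangle through `e` is a common neighbour of its ends; privacy makes it
  -- `w`, so the triangle is `s`.
  private-∉ : ∀ {e w s t} → Triangle s → Triangle t → Side e w s → Private (proj₁ e) (proj₂ e) w →
    s ≢ t → e ∉ clause t
  private-∉ tri-s tri-t side priv s≢t = ∉-clause λ w′ side′ →
    let _ , uw′ , vw′ = side-adj tri-t side′ in
    s≢t (side-determines tri-s tri-t side (subst (λ w → Side _ w _) (priv w′ uw′ vw′) side′))

  -- The private edge is set opposite to another side of `t`; no other triangle contains it, so none
  -- is affected.
  recolour : ∀ σ t → Triangle t → HasPrivateEdge t →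
    ∃ λ τ → Proper τ t × (∀ t′ → Triangle t′ → t ≢ t′ → Proper σ t′ → Proper τ t′)
  recolour σ t@(a , b , d) tri@(a<b , b<d , _) = λ where
      (inj₁ p) → separate σ ab′ bd′ ,
        (λ (e , _) → eval-separate σ ab′ bd′ (<⇒≢ a<b ∘ cong proj₁) e) , untouched ab p
      (inj₂ (inj₁ p)) → separate σ bd′ ab′ ,
        (λ (e , _) → eval-separate σ bd′ ab′ (<⇒≢ a<b ∘ sym ∘ cong proj₁) (sym e)) ,
        untouched bd p
      (inj₂ (inj₂ p)) → separate σ ad′ ab′ ,
        (λ (_ , e) → eval-separate σ ad′ ab′ (<⇒≢ b<d ∘ sym ∘ cong proj₂) (sym e)) ,
        untouched ad p
    where
    ab′ bd′ ad′ : Literal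
    ab′ = (a , b) , false
    bd′ = (b , d) , false
    ad′ = (a , d) , false
    untouched : ∀ {e w x} → Side e w t → Private (proj₁ e) (proj₂ e) w →
      ∀ t′ → Triangle t′ → t ≢ t′ → Proper σ t′ → Proper (assign σ (e , false) x) t′
    untouched side p t′ tri′ t≢t′ =
      NAE-assign σ (_ , false) _ (clause t′) (private-∉ tri tri′ side p t≢t′)

  triples triangles : List Triple
  triples   = cartesianProduct (allFin n) (cartesianProduct (allFin n) (allFin n))
  triangles = filter triangle? triples

  triangles-unique : Unique triangles
  triangles-unique = filter⁺ triangle?
    (cartesianProduct⁺ (allFin⁺ n) (cartesianProduct⁺ (allFin⁺ n) (allFin⁺ n)))

  ∈-triangles : ∀ {t} → Triangle t → t ∈ triangles
  ∈-triangles {a , b , d} = ∈-filter⁺ triangle?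
    (∈-cartesianProduct⁺ (∈-allFin a) (∈-cartesianProduct⁺ (∈-allFin b) (∈-allFin d)))

  stuck? : Decidable (¬_ ∘ HasPrivateEdge)
  stuck? = ¬? ∘ hasPrivateEdge?

  proper-on-stuck : Gem Free G ⊎ Book Free G →
    ∃ λ σ → ∀ t → Triangle t → ¬ HasPrivateEdge t → Proper σ t
  proper-on-stuck free =
    let σ , sat = twice-satisfiable (map clause stuck) twice
    in σ , λ t tri ¬free → All.lookup (All-map⁻ sat) (∈-filter⁺ stuck? (∈-triangles tri) ¬free)
    where
    stuck : List Triple
    stuck = filter stuck? triangles
    all-stuck : All (λ t → Triangle t × ¬ HasPrivateEdge t) stuck
    all-stuck = All.zip (All-filter⁺ stuck? (all-filter triangle? triples) , all-filter stuck? triangles)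
    twice : ∀ e → total e (map clause stuck) ≤ 2
    twice e = subst (λ l → sum l ≤ 2) (map-∘ stuck)
      (sum-indicator≤ (occurrences e ∘ clause) (filter⁺ stuck? triangles-unique)
        (All.map (λ (tri , ¬free) → Sum.map₂ (λ (1≡ , side) → 1≡ , (tri , ¬free) , side)
                                      (occurrences-clause e tri))
                 all-stuck)
        (at-most-two free e))

  -- The invariant covers every triangle without a private edge, not only those in the list: it is
  -- proper when reached, and recolouring another triangle never spoils it. Privacy refers to all of
  -- `G`, so one pass suffices.
  proper-on : (∃ λ σ → ∀ t → Triangle t → ¬ HasPrivateEdge t → Proper σ t) → ∀ {L} → All Triangle L →
    ∃ λ σ → (∀ t → Triangle t → ¬ HasPrivateEdge t → Proper σ t) × All (Proper σ) L
  proper-on (σ , proper) [] = σ , proper , []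
  proper-on base {t ∷ L} (tri ∷ tris) with proper-on base tris | hasPrivateEdge? t
  ... | σ , stuck-proper , L-proper | no ¬free = σ , stuck-proper , stuck-proper t tri ¬free ∷ L-proper
  ... | σ , stuck-proper , L-proper | yes free
    with τ , t-proper , keep ← recolour σ t tri free =
      τ
    , (λ t′ tri′ ¬free → keep t′ tri′ (λ { refl → ¬free free }) (stuck-proper t′ tri′ ¬free))
    , t-proper ∷ All.zipWith (λ { {t′} (tri′ , proper) → kept t′ tri′ proper }) (tris , L-proper)
    where
    kept : ∀ t′ → Triangle t′ → Proper σ t′ → Proper τ t′
    -- `t` may recur in `L`, while `keep` speaks of other triangles only.
    kept t′ tri′ proper with ≡-dec _≟_ _≟ₑ_ t t′
    ... | yes refl = t-proper
    ... | no t≢t′  = keep t′ tri′ t≢t′ proper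

  proper-colouring : Gem Free G ⊎ Book Free G → ∃ λ σ → ∀ t → Triangle t → Proper σ t
  proper-colouring free =
    let σ , _ , proper = proper-on (proper-on-stuck free) (all-filter triangle? triples)
    in σ , λ t tri → All.lookup proper (∈-triangles tri)

  -- From assignments to symmetric edge colourings

  colour : (Edge → Bool) → Fin n → Fin n → Bool
  -- At most one disjunct can hold; the diagonal gets the default `false`.
  colour σ u v = (does (u <? v) ∧ σ (u , v)) ∨ (does (v <? u) ∧ σ (v , u))

  colour-sym : ∀ σ u v → colour σ u v ≡ colour σ v u
  colour-sym σ u v = ∨-comm (does (u <? v) ∧ σ (u , v)) _

  colour-< : ∀ σ {u v} → u < v → colour σ u v ≡ σ (u , v)
  colour-< σ {u} {v} u<v
    rewrite dec-true (u <? v) u<v | dec-false (v <? u) (<-asym u<v) = ∨-identityʳ _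

  -- A monochromatic triangle may come in any order, while `proper` speaks of sorted triples; the
  -- two transpositions sort it.
  ¬monochromatic : ∀ {σ} → (∀ t → Triangle t → Proper σ t) → ¬ MonoTriangle G (colour σ)
  ¬monochromatic {σ} proper (a , b , d , mono) = any-order mono
    where
    c : Fin n → Fin n → Bool
    c = colour σ
    Mono : Fin n → Fin n → Fin n → Set
    Mono a b d = Adj G a b × Adj G b d × Adj G a d × c a b ≡ c b d × c a b ≡ c a d
    swap₁₂ : ∀ {a b d} → Mono a b d → Mono b a d
    swap₁₂ {a} {b} (ab′ , bd′ , ad′ , p , q) =
      Adj-sym G ab′ , ad′ , bd′ , trans (colour-sym σ b a) q , trans (colour-sym σ b a) p
    swap₂₃ : ∀ {a b d} → Mono a b d → Mono a d b
    swap₂₃ {a} {b} {d} (ab′ , bd′ , ad′ , p , q) =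
      ad′ , Adj-sym G bd′ , ab′ , trans (sym q) (trans p (colour-sym σ b d)) , sym q
    sorted : ∀ {a b d} → a < b → b < d → ¬ Mono a b d
    sorted a<b b<d (ab′ , bd′ , ad′ , p , q) = proper _ (a<b , b<d , ab′ , bd′ , ad′)
      ( trans (sym (colour-< σ a<b)) (trans p (colour-< σ b<d))
      , trans (sym (colour-< σ a<b)) (trans q (colour-< σ (<-trans a<b b<d))))
    half-sorted : ∀ {a b d} → a < b → ¬ Mono a b d
    half-sorted {a} {b} {d} a<b m@(_ , bd′ , ad′ , _) with <-cmp b d | <-cmp a d
    ... | tri< b<d _ _ | _            = sorted a<b b<d m
    ... | tri≈ _ b≡d _ | _            = Adj-≢ G bd′ b≡d
    ... | tri> _ _ d<b | tri< a<d _ _ = sorted a<d d<b (swap₂₃ m)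
    ... | tri> _ _ _   | tri≈ _ a≡d _ = Adj-≢ G ad′ a≡d
    ... | tri> _ _ _   | tri> _ _ d<a = sorted d<a a<b (swap₁₂ (swap₂₃ m))
    any-order : ∀ {a b d} → ¬ Mono a b d
    any-order {a} {b} m with <-cmp a b
    ... | tri< a<b _ _ = half-sorted a<b m
    ... | tri≈ _ a≡b _ = Adj-≢ G (proj₁ m) a≡b
    ... | tri> _ _ b<a = half-sorted b<a (swap₁₂ m)

  ¬arrows : Gem Free G ⊎ Book Free G → ¬ Arrows G
  ¬arrows free arrows =
    let σ , proper = proper-colouring free
    in ¬monochromatic proper (arrows (colour σ) (colour-sym σ))

-- Graphs on five vertices

-- The adjacency matrix above the diagonal. As finite data it turns a claim about all graphs on `n`
-- vertices into one decidable by enumeration.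
Triangular : ℕ → Set
Triangular zero    = ⊤
Triangular (suc n) = Vec Bool n × Triangular n

entry : ∀ {n} → Triangular n → Fin n → Fin n → Bool
entry (r , t) zero    zero    = false
entry (r , t) zero    (suc j) = lookup r j
entry (r , t) (suc i) zero    = lookup r i
entry (r , t) (suc i) (suc j) = entry t i j

deleteZero : ∀ {n} → Graph (suc n) → Graph n
deleteZero G = record
  { adj     = λ u v → adj G (suc u) (suc v)
  ; adj-sym = λ u v → adj-sym G (suc u) (suc v)
  ; adj-irr = λ u → adj-irr G (suc u)
  }

triangular : ∀ {n} → Graph n → Triangular n
triangular {zero}  G = tt
triangular {suc n} G = tabulate (λ j → adj G zero (suc j)) , triangular (deleteZero G)

entry-triangular : ∀ {n} (G : Graph n) u v → entry (triangular G) u v ≡ adj G u v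
entry-triangular G zero    zero    = sym (adj-irr G zero)
entry-triangular G zero    (suc j) = lookup∘tabulate _ j
entry-triangular G (suc i) zero    = trans (lookup∘tabulate _ i) (adj-sym G zero (suc i))
entry-triangular G (suc i) (suc j) = entry-triangular (deleteZero G) i j

∀Vec? : ∀ n {P : Vec Bool n → Set} → Decidable P → Dec (∀ v → P v)
∀Vec? zero    P? = map′ (λ { p [] → p }) (λ h → h []) (P? [])
∀Vec? (suc n) P? =
  map′ (λ { (p , q) (true ∷ v) → p v ; (p , q) (false ∷ v) → q v })
       (λ h → (λ v → h (true ∷ v)) , (λ v → h (false ∷ v)))
       (∀Vec? n (λ v → P? (true ∷ v)) ×-dec ∀Vec? n (λ v → P? (false ∷ v)))

∀Triangular? : ∀ n {P : Triangular n → Set} → Decidable P → Dec (∀ t → P t)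
∀Triangular? zero    P? = map′ (λ p _ → p) (λ h → h tt) (P? tt)
∀Triangular? (suc n) P? =
  map′ (λ h (r , t) → h r t) (λ h r t → h (r , t))
       (∀Vec? n λ r → ∀Triangular? n λ t → P? (r , t))

permutations : ∀ n → List (Permutation′ n)
permutations zero    = [ idₚ ]
permutations (suc n) = concatMap (λ i → map (insert zero i) (permutations n)) (allFin (suc n))

-- Unlisted pairs are unconstrained, so containment in a graph or in its complement and isomorphism
-- all fit one format.
Pattern : Set
Pattern = List ((Fin 5 × Fin 5) × Bool)

Matches : (Fin 5 → Fin 5 → Bool) → Pattern → Permutation′ 5 → Set
Matches r p π = All (λ ((u , v) , b) → r (π ⟨$⟩ʳ u) (π ⟨$⟩ʳ v) ≡ b) p

matches? : ∀ r p → Decidable (Matches r p)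
matches? r p π = All.all? (λ ((u , v) , b) → r (π ⟨$⟩ʳ u) (π ⟨$⟩ʳ v) ≟ᵇ b) p

exactly : Graph 5 → Pattern
exactly G = map (λ (u , v) → (u , v) , adj G u v) (upperPairs 5)

joined : Fin 4 × Fin 4 → (Fin 5 × Fin 5) × Bool
joined (u , v) = (inject₁ u , inject₁ v) , true

-- The first two say that the complement contains P₄ or K₃; they list exactly the non-edges of `Gem`
-- and of `Book`. The third is K₄. The only disjoint unions of stars on five vertices without four
-- independent vertices are P₂ ∪ P₂ ∪ P₁ and P₂ ∪ P₃, the complements of the last two.
patterns : List Pattern
patterns =
    (((v0 , v1) , false) ∷ ((v1 , v2) , false) ∷ ((v2 , v3) , false) ∷ [])
  ∷ (((v0 , v1) , false) ∷ ((v1 , v2) , false) ∷ ((v0 , v2) , false) ∷ [])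
  ∷ map joined (upperPairs 4)
  ∷ exactly W5
  ∷ exactly (complement P2∪P3)
  ∷ []

-- Verified by evaluation on all 2¹⁰ graphs.  The reason is that a graph (here the complement of H)
-- containing neither P₄ nor K₃ is a disjoint union of stars.
pattern-matches : ∀ t → Any (∃ ∘ Matches (entry t)) patterns
pattern-matches t = Any.map Any.satisfied (toWitness
  {a? = ∀Triangular? 5 λ t → any? (λ p → any? (matches? (entry t) p) (permutations 5)) patterns} _ t)

relabel : ∀ {n} → Permutation′ n → Graph n → Graph n
relabel π G = record
  { adj     = λ u v → adj G (π ⟨$⟩ʳ u) (π ⟨$⟩ʳ v)
  ; adj-sym = λ u v → adj-sym G (π ⟨$⟩ʳ u) (π ⟨$⟩ʳ v)
  ; adj-irr = λ u → adj-irr G (π ⟨$⟩ʳ u)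
  }

Contains-trans : ∀ {l m n} (G : Graph l) (H : Graph m) (I : Graph n) →
  Contains G H → Contains H I → Contains G I
Contains-trans _ _ _ (f , f-inj , f-hom) (g , g-inj , g-hom) =
  f ∘ g , g-inj ∘ f-inj , λ u v → f-hom (g u) (g v) ∘ g-hom u v

contains-relabelled : ∀ {n} (π : Permutation′ n) (G : Graph n) → Contains G (relabel π G)
contains-relabelled π G = π ⟨$⟩ʳ_ , injective π , λ _ _ → id
  where
  injective : ∀ (π : Permutation′ _) {u v} → π ⟨$⟩ʳ u ≡ π ⟨$⟩ʳ v → u ≡ v
  injective π eq = trans (sym (inverseˡ π)) (trans (cong (π ⟨$⟩ˡ_) eq) (inverseˡ π))

≅-relabelled : ∀ {n} (π : Permutation′ n) (G K : Graph n) →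
  (∀ u v → adj K u v ≡ adj (relabel π G) u v) → G ≅ K
≅-relabelled π G K agree = record
  -- Vertex `u` of `relabel π G` is the vertex `π ⟨$⟩ʳ u` of `G`, so the map out of `G` is the
  -- inverse.
  { to      = π ⟨$⟩ˡ_
  ; from    = π ⟨$⟩ʳ_
  ; to-from = λ _ → inverseˡ π
  ; from-to = λ _ → inverseʳ π
  ; pres    = λ u v → trans (agree _ _) (cong₂ (adj G) (inverseʳ π) (inverseʳ π))
  }

≅⇒Contains : ∀ {n} (G K : Graph n) → G ≅ K → Contains K G
≅⇒Contains _ _ G≅K =
    to
  , (λ {u} {v} eq → trans (sym (from-to u)) (trans (cong from eq) (from-to v)))
  , λ u v → trans (pres u v)
  where open _≅_ G≅K

agree-from-exactly : ∀ π (G K : Graph 5) → Matches (adj G) (exactly K) π →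
  ∀ u v → adj K u v ≡ adj (relabel π G) u v
agree-from-exactly π G K m = from-upperPairs
  (λ u → trans (adj-irr K u) (sym (adj-irr (relabel π G) u)))
  (λ {u} {v} eq → trans (adj-sym K v u) (trans eq (adj-sym (relabel π G) u v)))
  (All.map sym (All-map⁻ m))

-- In the first two cases the relabelled `H` lacks every pair that the target lacks, so the identity
-- embeds it; the other three cases contradict the hypotheses.
gem-or-book : (H : Graph 5) → (K 4) Free H → ¬ (H ≅ W5) → ¬ (H ≅ complement P2∪P3) →
  Contains Gem H ⊎ Contains Book H
gem-or-book H K4-free ¬W5 ¬P2∪P3 = classify (pattern-matches (triangular H))
  where
  r : Fin 5 → Fin 5 → Bool
  r = entry (triangular H)
  actual : ∀ p π → Matches r p π → Matches (adj H) p π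
  actual p π = All.map λ { {(u , v) , _} → trans (sym (entry-triangular H (π ⟨$⟩ʳ u) (π ⟨$⟩ʳ v))) }
  non-edge : ∀ {π u v} {A : Set} → r (π ⟨$⟩ʳ u) (π ⟨$⟩ʳ v) ≡ false → Adj (relabel π H) u v → A
  non-edge ¬uv uv =
    contradiction (trans (sym uv) (trans (sym (entry-triangular H _ _)) ¬uv)) λ ()
  embed : ∀ K π → All (λ (u , v) → Adj (relabel π H) u v → Adj K u v) (upperPairs 5) →
    Contains K H
  embed K π h = Contains-trans K (relabel π H) H
    (id , id , hom-from-upperPairs K (relabel π H) id h)
    (≅⇒Contains H (relabel π H) (≅-relabelled π H (relabel π H) λ _ _ → refl))
  classify : Any (∃ ∘ Matches r) patterns →
    Contains Gem H ⊎ Contains Book H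
  classify (here (π , n01 ∷ n12 ∷ n23 ∷ [])) = inj₁ (embed Gem π
    ( non-edge {π} n01 ∷ (λ _ → refl) ∷ (λ _ → refl) ∷ (λ _ → refl)
    ∷ non-edge {π} n12 ∷ (λ _ → refl) ∷ (λ _ → refl)
    ∷ non-edge {π} n23 ∷ (λ _ → refl) ∷ (λ _ → refl) ∷ []))
  classify (there (here (π , n01 ∷ n12 ∷ n02 ∷ []))) = inj₂ (embed Book π
    ( non-edge {π} n01 ∷ non-edge {π} n02 ∷ (λ _ → refl) ∷ (λ _ → refl)
    ∷ non-edge {π} n12 ∷ (λ _ → refl) ∷ (λ _ → refl)
    ∷ (λ _ → refl) ∷ (λ _ → refl) ∷ (λ _ → refl) ∷ []))
  classify (there (there (here (π , m)))) =
    contradiction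
      (Contains-trans H (relabel π H) (K 4) (contains-relabelled π H)
        ( inject₁ , inject₁-injective
        , hom-from-upperPairs (relabel π H) (K 4) inject₁
            (All.map const (All-map⁻ {f = joined} (actual (map joined (upperPairs 4)) π m)))))
      K4-free
  classify (there (there (there (here (π , m))))) =
    contradiction (≅-relabelled π H W5 (agree-from-exactly π H W5 (actual (exactly W5) π m))) ¬W5
  classify (there (there (there (there (here (π , m)))))) =
    contradiction
      (≅-relabelled π H coP (agree-from-exactly π H coP (actual (exactly coP) π m))) ¬P2∪P3
    where coP = complement P2∪P3

theorem9 : (H : Graph 5) → Connected H → (K 4) Free H → Contains H (K 3)
    → ¬ (H ≅ W5) → ¬ (H ≅ complement P2∪P3) → ¬ FolkmanExists H
theorem9 H _ K4-free _ ¬W5 ¬P2∪P3 (n , G , H-free , arrows) =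
  -- A graph avoiding `H` avoids every graph that contains `H`.
  ¬arrows G (Sum.map (free Gem) (free Book) (gem-or-book H K4-free ¬W5 ¬P2∪P3)) arrows
  where
  free : ∀ K → Contains K H → K Free G
  free K K⊇H G⊇K = H-free (Contains-trans G K H G⊇K K⊇H)
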